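{- Let $n,s,t,\delta$ be integers with $s\ge 2$ and $3\le t+1\le \delta\le \left\lfloor \frac{n+t-2}{2}\right\rfloor$, and let $h=\left\lfloor \frac{n+t-2}{2}\right\rfloor$. Put $$f_1(n,t,\delta,s)=\binom{n+t-\delta-1}{s}+(\delta-t+1)\binom{\delta}{s-1},$$ $$g_1(n,t,\delta,s)=\binom{n+t-h-1}{s}+(h-t)\binom{h}{s-1}+\binom{\delta}{s-1}.$$ Let $G$ be a finite, simple, connected graph of order $n$ with minimum degree $\delta$. If $$N_s(G)>\max\{f_1(n,t,\delta,s),\,g_1(n,t,\delta,s)\},$$ then $G$ is one-to-many $t$-disjoint path coverable.
   Context: The order of a graph is its number of vertices. $N_s(G)$ is the number of $s$-cliques of $G$, i.e. of sets of exactly $s$ vertices of $G$ that are pairwise adjacent. A graph $G$ is one-to-many $t$-disjoint path coverable if for any vertex $u$ and any set $\{v_1,\dots,v_t\}$ of $t$ distinct vertices of $G$ not containing $u$, there exist $t$ paths $P_1,\dots,P_t$ in $G$ such that $P_i$ joins $u$ and $v_i$, every vertex of $G$ lies on at least one of the paths, and any two of the paths have no common vertex other than $u$. Binomial coefficients $\binom{a}{b}$ with integers $0\le a<b$ are $0$. -}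

module Defs where

open import Data.Fin using (Fin)
open import Data.Fin.Properties using (all?; _≟_)
open import Data.Fin.Subset using (Subset; inside; outside; _∈_; ∣_∣)
open import Data.Fin.Subset.Properties using (_∈?_)
open import Data.List using (List; []; _∷_; _++_; map; filter; length; allFin)
import Data.List.Membership.Propositional as List
open import Data.List.Relation.Unary.Unique.Propositional using (Unique)
open import Data.Nat as ℕ using (ℕ; zero; suc; _+_; _∸_; _*_; _≤_)
open import Data.Nat.Combinatorics using (_C_)
open import Data.Nat.DivMod using (_/_)
open import Data.Product using (Σ; ∃; _×_; proj₁)
import Data.Vec as Vec
open import Function.Definitions using (Injective)
open import Level using (0ℓ)
open import Relation.Binary using (Rel; Decidable; Symmetric; Irreflexive)
open import Relation.Binary.Construct.Closure.ReflexiveTransitive using (Star; ε; _◅_)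
open import Relation.Binary.PropositionalEquality using (_≡_; _≢_)
open import Relation.Nullary using (Dec; ¬?; _×-dec_; _→-dec_)

-- Finite simple graphs of order n, with vertex set Fin n.
-- Adjacency is decidable, so that degrees and cliques can be counted.
record Graph (n : ℕ) : Set₁ where
  infix 4 _~_ _~?_
  field
    _~_    : Rel (Fin n) 0ℓ
    _~?_   : Decidable _~_
    sym    : Symmetric _~_
    irrefl : Irreflexive _≡_ _~_

allSubsets : (n : ℕ) → List (Subset n)
allSubsets zero    = Vec.[] ∷ []
allSubsets (suc n) = map (outside Vec.∷_) (allSubsets n) ++ map (inside Vec.∷_) (allSubsets n)

module _ {n : ℕ} (G : Graph n) where
  open Graph G

  degree : Fin n → ℕ
  degree v = length (filter (v ~?_) (allFin n))

  HasMinDegree : ℕ → Set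
  HasMinDegree δ = (∃ λ v → degree v ≡ δ) × (∀ v → δ ≤ degree v)

  Connected : Set
  Connected = ∀ u v → Star _~_ u v

  PairwiseAdjacent : Subset n → Set
  PairwiseAdjacent K = ∀ x y → x ∈ K → y ∈ K → x ≢ y → x ~ y

  IsClique : ℕ → Subset n → Set
  IsClique s K = ∣ K ∣ ≡ s × PairwiseAdjacent K

  isClique? : ∀ s K → Dec (IsClique s K)
  isClique? s K = (∣ K ∣ ℕ.≟ s) ×-dec
    all? λ x → all? λ y →
      (x ∈? K) →-dec (y ∈? K) →-dec ¬? (x ≟ y) →-dec (x ~? y)

  numCliques : ℕ → ℕ
  numCliques s = length (filter (isClique? s) (allSubsets n))

  -- A walk is an element of Star _~_ u v; both end vertices are listed.
  vertices : ∀ {u v} → Star _~_ u v → List (Fin n)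
  vertices {u} ε       = u ∷ []
  vertices {u} (_ ◅ w) = u ∷ vertices w

  Path : Fin n → Fin n → Set
  Path u v = Σ (Star _~_ u v) λ w → Unique (vertices w)

  infix 4 _∈ₚ_
  _∈ₚ_ : ∀ {u v} → Fin n → Path u v → Set
  x ∈ₚ P = x List.∈ vertices (proj₁ P)

  -- The set {v₁, …, vₜ} of t distinct vertices is given by an injective
  -- enumeration v.
  OneToManyDisjointPathCoverable : ℕ → Set
  OneToManyDisjointPathCoverable t =
    ∀ (u : Fin n) (v : Fin t → Fin n) →
    Injective _≡_ _≡_ v → (∀ i → v i ≢ u) →
    Σ (∀ i → Path u (v i)) λ P →
      (∀ x → ∃ λ i → x ∈ₚ P i) ×
      (∀ i j → i ≢ j → ∀ x → x ∈ₚ P i → x ∈ₚ P j → x ≡ u)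

-- When s ≥ 2 and 3 ≤ t + 1 ≤ δ ≤ h, every truncated subtraction below agrees with
-- integer subtraction.
h : (n t : ℕ) → ℕ
h n t = (n + t ∸ 2) / 2

f₁ : (n t δ s : ℕ) → ℕ
f₁ n t δ s = (n + t ∸ δ ∸ 1) C s + (δ ∸ t + 1) * (δ C (s ∸ 1))

g₁ : (n t δ s : ℕ) → ℕ
g₁ n t δ s = (n + t ∸ h n t ∸ 1) C s + (h n t ∸ t) * (h n t C (s ∸ 1)) + δ C (s ∸ 1)

{-# OPTIONS --safe #-}
module Submission where

-- Bondy–Chvátal closure.  If d(x) + d(y) ≥ n + t − 1, a rotation turns a spanning
-- system of t paths in G + xy into one in G, so it suffices to treat a supergraph H
-- of G in which non-adjacent vertices have degree sum at most n + t − 2.  If H is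
-- complete, the paths are immediate.  Otherwise take x ≁ y in H with maximal degree
-- sum and k = d(x) ≤ d(y); then δ ≤ k ≤ h, and the non-neighbours of y give k − t + 1
-- vertices of degree at most k in G, one of which may be taken to have degree δ.
-- Removing them one at a time shows
--   N_s(G) ≤ C(n+t−k−1, s) + (k−t) C(k, s−1) + C(δ, s−1).
-- The right-hand side is convex in k and equals f₁ at k = δ and g₁ at k = h.

open import Defs
open import Data.Nat using (ℕ; _+_; _≤_; _≥_; _>_; _⊔_)

open import Data.Bool.Base using (true; false)
open import Data.Fin.Base using (Fin; zero; suc)
open import Data.Fin.Properties using (_≟_; any?)
import Data.Fin.Properties as Fin
open import Data.Fin.Subset using (Subset; inside; outside; _⊆_; ∣_∣; _-_)
  renaming (_∈_ to _∈ₛ_; ⊤ to full)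
open import Data.Fin.Subset.Properties
  using (_⊆?_; ∈⊤; ∣⊤∣≡n; drop-there; drop-∷-⊆; x∈p∧x≢y⇒x∈p-y; x∈p⇒∣p-x∣<∣p∣)
  renaming (_∈?_ to _∈ₛ?_)
open import Data.List.Base
  using (List; []; _∷_; [_]; _++_; map; filter; length; allFin; take; tabulate; cartesianProduct)
open import Data.List.Membership.Propositional using (_∈_; _∉_)
open import Data.List.Membership.Propositional.Properties
  using (∈-++⁺ˡ; ∈-++⁺ʳ; ∈-++⁻; ∈-∃++; ∈-allFin; ∈-cartesianProduct⁺; ∈-filter⁺; ∈-filter⁻)
open import Data.List.Properties
  using (length-++; ++-assoc; filter-++; length-filter; length-tabulate; filter-none; filter-all;
         length-take)
open import Data.List.Relation.Binary.Permutation.Propositional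
open import Data.List.Relation.Binary.Permutation.Propositional.Properties
  using (++⁺ˡ; ++⁺ʳ; ++-comm; shift; shifts; ∷↭∷ʳ; ↭-length; filter-↭; ∈-resp-↭)
open import Data.List.Relation.Unary.All as All using (All; []; _∷_)
import Data.List.Relation.Unary.All.Properties as All
open import Data.List.Relation.Unary.AllPairs using ([]; _∷_)
open import Data.List.Relation.Unary.Any using (here; there)
open import Data.List.Relation.Unary.Unique.Propositional using (Unique)
import Data.List.Relation.Unary.Unique.Propositional.Properties as Unique
open import Data.Nat.Base hiding (_/_)
open import Data.Nat.Combinatorics using (_C_; nCk+nC[k+1]≡[n+1]C[k+1])
open import Data.Nat.DivMod using (_/_; m*n/n≡m; /-monoˡ-≤)
open import Data.Nat.Induction using (Acc; acc; <-wellFounded)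
open import Data.Nat.ListAction using (sum)
open import Data.Nat.Properties hiding (_≟_)
open import Data.Nat.Solver using (module +-*-Solver)
open import Data.List.Extrema ≤-totalOrder using (argmax; argmax-all; f[xs]≤f[argmax])
open import Data.Product.Base using (∃; ∃₂; _×_; _,_; proj₁; proj₂; uncurry)
open import Data.Sum.Base using (_⊎_; inj₁; inj₂; [_,_]′)
open import Data.Unit.Base using (⊤; tt)
import Data.Vec.Base as Vec
open import Data.Vec.Properties using (lookup∘tabulate; lookup⇒[]=)
open import Function.Base using (_∘_; id)
open import Function.Definitions using (Injective)
open import Level using (0ℓ)
open import Relation.Binary.Construct.Closure.ReflexiveTransitive using (Star; ε; _◅_)
open import Relation.Binary.Core using (Rel)
open import Relation.Binary.Definitions using (Symmetric)
open import Relation.Binary.PropositionalEquality as ≡ using (_≡_; _≢_; cong; cong₂; subst)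
open import Relation.Nullary using (Dec; yes; no; ¬_; ¬?; does; _×-dec_; _⊎-dec_; contradiction)
open import Relation.Nullary.Decidable using (dec-true; decidable-stable)
open import Relation.Unary using (Pred; Decidable)

-- Choosing a non-adjacent pair with maximal degree sum turns a bound on sums into one on single
-- degrees: a non-neighbour z of y satisfies d(z) + d(y) ≤ d(x) + d(y), so d(z) ≤ k, and d(y) ≤ n +
-- t - 2 - k leaves at least k - t + 1 such vertices. Cliques are counted in G and not in H because
-- a vertex of degree δ in G may have gained edges in H. Its separate term C(δ, s-1) is what
-- distinguishes `g₁` from `f₁` read at δ = h; at k = δ it merges with the k - t other terms, whence
-- the factor δ - t + 1 in `f₁`. The rotations rest on a pigeonhole count over consecutive pairs of
-- vertices along the legs. An edge from y to the common start u can only be charged to a leg other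
-- than the broken one, so there must be such a leg: this is where t ≥ 2 enters.

private variable
  V W : Set
  E : Rel V 0ℓ
  P Q R : Pred V 0ℓ
  a b c d u : V
  L M ts ts′ : List V

-- Counting cliques

count : {P : Pred V 0ℓ} → Decidable P → List V → ℕ
count P? = length ∘ filter P?

count-++ : (P? : Decidable P) → ∀ xs ys → count P? (xs ++ ys) ≡ count P? xs + count P? ys
count-++ P? xs ys = ≡.trans (cong length (filter-++ P? xs ys)) (length-++ (filter P? xs))

count-map : {P : Pred W 0ℓ} (P? : Decidable P) (f : V → W) → ∀ xs →
  count P? (map f xs) ≡ count (P? ∘ f) xs
count-map P? f []       = ≡.refl
count-map P? f (x ∷ xs) with does (P? (f x))
... | true  = cong suc (count-map P? f xs)
... | false = count-map P? f xs

count-none : (P? : Decidable P) → (∀ x → ¬ P x) → ∀ xs → count P? xs ≡ 0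
count-none P? ¬P []       = ≡.refl
count-none P? ¬P (x ∷ xs) with P? x
... | yes px = contradiction px (¬P x)
... | no  _  = count-none P? ¬P xs

count-∪ : (P? : Decidable P) (Q? : Decidable Q) (R? : Decidable R) →
  (∀ {x} → P x → Q x ⊎ R x) → ∀ xs → count P? xs ≤ count Q? xs + count R? xs
count-∪ P? Q? R? P⊆ []       = z≤n
count-∪ P? Q? R? P⊆ (x ∷ xs) with ih ← count-∪ P? Q? R? P⊆ xs | P? x | Q? x | R? x
... | no _  | no _   | no _  = ih
... | no _  | no _   | yes _ = ≤-trans ih (+-monoʳ-≤ (count Q? xs) (n≤1+n _))
... | no _  | yes _  | no _  = m≤n⇒m≤1+n ih
... | no _  | yes _  | yes _ = m≤n⇒m≤1+n (≤-trans ih (+-monoʳ-≤ (count Q? xs) (n≤1+n _)))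
... | yes _ | yes _  | no _  = s≤s ih
... | yes _ | yes _  | yes _ = s≤s (≤-trans ih (+-monoʳ-≤ (count Q? xs) (n≤1+n _)))
... | yes _ | no _   | yes _ = ≤-trans (s≤s ih) (≤-reflexive (≡.sym (+-suc (count Q? xs) _)))
... | yes p | no ¬q  | no ¬r with P⊆ p
...   | inj₁ q = contradiction q ¬q
...   | inj₂ r = contradiction r ¬r

count-mono : (P? : Decidable P) (Q? : Decidable Q) →
  (∀ {x} → P x → Q x) → ∀ xs → count P? xs ≤ count Q? xs
count-mono P? Q? P⊆Q []       = z≤n
count-mono P? Q? P⊆Q (x ∷ xs) with ih ← count-mono P? Q? P⊆Q xs | P? x | Q? x
... | no _  | no _  = ih
... | no _  | yes _ = m≤n⇒m≤1+n ih
... | yes _ | yes _ = s≤s ih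
... | yes p | no ¬q = contradiction (P⊆Q p) ¬q

C-monoˡ-suc : ∀ n k → n C k ≤ suc n C k
C-monoˡ-suc n zero    = ≤-refl
C-monoˡ-suc n (suc k) = ≤-trans (m≤n+m _ _) (≤-reflexive (nCk+nC[k+1]≡[n+1]C[k+1] n k))

C-monoˡ-≤ : ∀ {m n} k → m ≤ n → m C k ≤ n C k
C-monoˡ-≤ {m} k m≤n with m≤n⇒∃[o]m+o≡n m≤n
... | o , ≡.refl = go o where
  go : ∀ o → m C k ≤ (m + o) C k
  go zero    = ≤-reflexive (cong (_C k) (≡.sym (+-identityʳ m)))
  go (suc o) = ≤-trans (go o)
    (≤-trans (C-monoˡ-suc (m + o) k) (≤-reflexive (cong (_C k) (≡.sym (+-suc m o)))))

count-allSubsets : ∀ {n} {P : Pred (Subset (suc n)) 0ℓ} (P? : Decidable P) →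
  count P? (allSubsets (suc n)) ≡
  count (P? ∘ (outside Vec.∷_)) (allSubsets n) + count (P? ∘ (inside Vec.∷_)) (allSubsets n)
count-allSubsets {n} P? = ≡.trans
  (count-++ P? (map (outside Vec.∷_) (allSubsets n)) _)
  (cong₂ _+_ (count-map P? _ (allSubsets n)) (count-map P? _ (allSubsets n)))

zero∉outside : ∀ {n} {K : Subset n} → ¬ (zero ∈ₛ outside Vec.∷ K)
zero∉outside ()

-- The predicate stays arbitrary because the recursion replaces it by its compositions with
-- `outside ∷_` and `inside ∷_`. Where the head lies in `T`, the two halves give the two terms of
-- Pascal's rule.
count-subsets : ∀ {n} (T : Subset n) r {P : Pred (Subset n) 0ℓ} (P? : Decidable P) →
  (∀ {K} → P K → K ⊆ T × ∣ K ∣ ≡ r) → count P? (allSubsets n) ≤ ∣ T ∣ C r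
count-subsets Vec.[] zero P? P⇒ with P? Vec.[]
... | yes _ = ≤-refl
... | no  _ = z≤n
count-subsets Vec.[] (suc r) P? P⇒ with P? Vec.[]
... | yes p with () ← proj₂ (P⇒ p)
... | no  _ = z≤n
count-subsets {suc n} (outside Vec.∷ T) r P? P⇒ = begin
  count P? (allSubsets (suc n))
    ≡⟨ count-allSubsets P? ⟩
  count (P? ∘ (outside Vec.∷_)) (allSubsets n) + count (P? ∘ (inside Vec.∷_)) (allSubsets n)
    ≤⟨ +-mono-≤
         (count-subsets T r (P? ∘ (outside Vec.∷_)) λ p → drop-∷-⊆ (proj₁ (P⇒ p)) , proj₂ (P⇒ p))
         (≤-reflexive (count-none (P? ∘ (inside Vec.∷_))
           (λ K p → zero∉outside (proj₁ (P⇒ p) Vec.here)) (allSubsets n))) ⟩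
  ∣ T ∣ C r + 0
    ≡⟨ +-identityʳ _ ⟩
  ∣ T ∣ C r ∎
  where open ≤-Reasoning
count-subsets {suc n} (inside Vec.∷ T) zero P? P⇒ = begin
  count P? (allSubsets (suc n))
    ≡⟨ count-allSubsets P? ⟩
  count (P? ∘ (outside Vec.∷_)) (allSubsets n) + count (P? ∘ (inside Vec.∷_)) (allSubsets n)
    ≤⟨ +-mono-≤
         (count-subsets T 0 (P? ∘ (outside Vec.∷_)) λ p → drop-∷-⊆ (proj₁ (P⇒ p)) , proj₂ (P⇒ p))
         (≤-reflexive (count-none (P? ∘ (inside Vec.∷_))
           (λ K p → 1+n≢0 (proj₂ (P⇒ p))) (allSubsets n))) ⟩
  1 ∎
  where open ≤-Reasoning
count-subsets {suc n} (inside Vec.∷ T) (suc r) P? P⇒ = begin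
  count P? (allSubsets (suc n))
    ≡⟨ count-allSubsets P? ⟩
  count (P? ∘ (outside Vec.∷_)) (allSubsets n) + count (P? ∘ (inside Vec.∷_)) (allSubsets n)
    ≤⟨ +-mono-≤
         (count-subsets T (suc r) (P? ∘ (outside Vec.∷_))
           λ p → drop-∷-⊆ (proj₁ (P⇒ p)) , proj₂ (P⇒ p))
         (count-subsets T r (P? ∘ (inside Vec.∷_))
           λ p → drop-∷-⊆ (proj₁ (P⇒ p)) , suc-injective (proj₂ (P⇒ p))) ⟩
  ∣ T ∣ C suc r + ∣ T ∣ C r
    ≡⟨ +-comm (∣ T ∣ C suc r) _ ⟩
  ∣ T ∣ C r + ∣ T ∣ C suc r
    ≡⟨ nCk+nC[k+1]≡[n+1]C[k+1] ∣ T ∣ r ⟩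
  suc ∣ T ∣ C suc r ∎
  where open ≤-Reasoning

∈⇒∣∣≢0 : ∀ {n} {v : Fin n} {K} → v ∈ₛ K → ∣ K ∣ ≢ 0
∈⇒∣∣≢0 {K = inside  Vec.∷ K} v∈K         = 1+n≢0
∈⇒∣∣≢0 {K = outside Vec.∷ K} (Vec.there v∈K) = ∈⇒∣∣≢0 v∈K

-- Without `v`, such a set is an `r`-subset of `T`. The recursion descends to the position of `v`
-- and drops that entry there, so no deletion map on subsets is required.
count-subsets-∋ : ∀ {n} (v : Fin n) (T : Subset n) r {P : Pred (Subset n) 0ℓ} (P? : Decidable P) →
  (∀ {K} → P K → v ∈ₛ K × (∀ {z} → z ∈ₛ K → z ≢ v → z ∈ₛ T) × ∣ K ∣ ≡ suc r) →
  count P? (allSubsets n) ≤ ∣ T ∣ C r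
count-subsets-∋ {suc n} zero (b Vec.∷ T) r P? P⇒ = begin
  count P? (allSubsets (suc n))
    ≡⟨ count-allSubsets P? ⟩
  count (P? ∘ (outside Vec.∷_)) (allSubsets n) + count (P? ∘ (inside Vec.∷_)) (allSubsets n)
    ≡⟨ cong (_+ count (P? ∘ (inside Vec.∷_)) (allSubsets n))
         (count-none (P? ∘ (outside Vec.∷_)) (λ K p → zero∉outside (proj₁ (P⇒ p))) (allSubsets n)) ⟩
  count (P? ∘ (inside Vec.∷_)) (allSubsets n)
    ≤⟨ count-subsets T r (P? ∘ (inside Vec.∷_)) (λ p →
         (λ z∈K → drop-there (proj₁ (proj₂ (P⇒ p)) (Vec.there z∈K) λ ())) ,
         suc-injective (proj₂ (proj₂ (P⇒ p)))) ⟩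
  ∣ T ∣ C r
    ≤⟨ C-monoˡ-≤ r (tail-≤ b) ⟩
  ∣ b Vec.∷ T ∣ C r ∎
  where
  open ≤-Reasoning
  tail-≤ : ∀ b → ∣ T ∣ ≤ ∣ b Vec.∷ T ∣
  tail-≤ true  = n≤1+n _
  tail-≤ false = ≤-refl
count-subsets-∋ {suc n} (suc v) (outside Vec.∷ T) r P? P⇒ = begin
  count P? (allSubsets (suc n))
    ≡⟨ count-allSubsets P? ⟩
  count (P? ∘ (outside Vec.∷_)) (allSubsets n) + count (P? ∘ (inside Vec.∷_)) (allSubsets n)
    ≡⟨ cong (count (P? ∘ (outside Vec.∷_)) (allSubsets n) +_)
         (count-none (P? ∘ (inside Vec.∷_))
           (λ K p → zero∉outside (proj₁ (proj₂ (P⇒ p)) Vec.here λ ())) (allSubsets n)) ⟩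
  count (P? ∘ (outside Vec.∷_)) (allSubsets n) + 0
    ≡⟨ +-identityʳ _ ⟩
  count (P? ∘ (outside Vec.∷_)) (allSubsets n)
    ≤⟨ count-subsets-∋ v T r (P? ∘ (outside Vec.∷_)) (λ p →
         drop-there (proj₁ (P⇒ p)) ,
         (λ z∈K z≢v → drop-there (proj₁ (proj₂ (P⇒ p)) (Vec.there z∈K) (z≢v ∘ Fin.suc-injective))) ,
         proj₂ (proj₂ (P⇒ p))) ⟩
  ∣ T ∣ C r ∎
  where
  open ≤-Reasoning
count-subsets-∋ {suc n} (suc v) (inside Vec.∷ T) r P? P⇒ = begin
  count P? (allSubsets (suc n))
    ≡⟨ count-allSubsets P? ⟩
  count (P? ∘ (outside Vec.∷_)) (allSubsets n) + count (P? ∘ (inside Vec.∷_)) (allSubsets n)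
    ≤⟨ +-monoˡ-≤ _ (count-subsets-∋ v T r (P? ∘ (outside Vec.∷_)) λ p →
         drop-there (proj₁ (P⇒ p)) , rest p , proj₂ (proj₂ (P⇒ p))) ⟩
  ∣ T ∣ C r + count (P? ∘ (inside Vec.∷_)) (allSubsets n)
    ≤⟨ with-zero r P⇒ ⟩
  suc ∣ T ∣ C r ∎
  where
  open ≤-Reasoning
  rest : ∀ {b K} → _ → ∀ {z} → z ∈ₛ K → z ≢ v → z ∈ₛ T
  rest {b} {K} p {z} z∈K z≢v =
    drop-there (proj₁ (proj₂ (P⇒ {b Vec.∷ K} p)) (Vec.there z∈K) (z≢v ∘ Fin.suc-injective))
  -- Sets that contain both the head and `v` have at least two elements: for `r = 0` there are none,
  -- and otherwise they supply the second term of Pascal's rule.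
  with-zero : ∀ r → (∀ {K} → _ → suc v ∈ₛ K × _ × ∣ K ∣ ≡ suc r) →
    ∣ T ∣ C r + count (P? ∘ (inside Vec.∷_)) (allSubsets n) ≤ suc ∣ T ∣ C r
  with-zero zero P⇒ = ≤-reflexive (cong suc (count-none (P? ∘ (inside Vec.∷_))
    (λ K p → ∈⇒∣∣≢0 (drop-there (proj₁ (P⇒ p))) (suc-injective (proj₂ (proj₂ (P⇒ p))))) (allSubsets n)))
  with-zero (suc r) P⇒ = begin
    ∣ T ∣ C suc r + count (P? ∘ (inside Vec.∷_)) (allSubsets n)
      ≤⟨ +-monoʳ-≤ (∣ T ∣ C suc r) (count-subsets-∋ v T r (P? ∘ (inside Vec.∷_)) λ p →
           drop-there (proj₁ (P⇒ p)) , rest p , suc-injective (proj₂ (proj₂ (P⇒ p)))) ⟩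
    ∣ T ∣ C suc r + ∣ T ∣ C r
      ≡⟨ +-comm (∣ T ∣ C suc r) _ ⟩
    ∣ T ∣ C r + ∣ T ∣ C suc r
      ≡⟨ nCk+nC[k+1]≡[n+1]C[k+1] ∣ T ∣ r ⟩
    suc ∣ T ∣ C suc r ∎

∣tabulate∣ : ∀ {n} {P : Pred V 0ℓ} (P? : Decidable P) (f : Fin n → V) →
  ∣ Vec.tabulate (does ∘ P? ∘ f) ∣ ≡ count P? (tabulate f)
∣tabulate∣ {n = zero}  P? f = ≡.refl
∣tabulate∣ {n = suc n} P? f with does (P? (f zero))
... | true  = cong suc (∣tabulate∣ P? (f ∘ suc))
... | false = ∣tabulate∣ P? (f ∘ suc)

module _ {n} (G : Graph n) where
  open Graph G hiding (sym)

  neighbours : Fin n → Subset n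
  neighbours v = Vec.tabulate (does ∘ (v ~?_))

  ∈-neighbours : ∀ {v z} → v ~ z → z ∈ₛ neighbours v
  ∈-neighbours {v} {z} v~z =
    lookup⇒[]= z _ (≡.trans (lookup∘tabulate _ z) (dec-true (v ~? z) v~z))

  -- The other `r` vertices of a clique through `v` are neighbours of `v`.
  numCliques-∋ : ∀ r v →
    count (λ K → isClique? G (suc r) K ×-dec v ∈ₛ? K) (allSubsets n) ≤ degree G v C r
  numCliques-∋ r v = ≤-trans
    (count-subsets-∋ v (neighbours v) r (λ K → isClique? G (suc r) K ×-dec v ∈ₛ? K)
      λ ((∣K∣≡ , adj) , v∈K) →
        v∈K , (λ {z} z∈K z≢v → ∈-neighbours (adj v z v∈K z∈K (z≢v ∘ ≡.sym))) , ∣K∣≡)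
    (≤-reflexive (cong (_C r) (∣tabulate∣ (v ~?_) id)))

  -- A clique inside `T` either contains the head of `D` or survives in `T - v`. Shrinking `T`
  -- instead of passing to induced subgraphs keeps `G`, and with it the degrees, fixed.
  numCliques-⊆ : ∀ r m (D : List (Fin n)) → Unique D → (T : Subset n) → All (_∈ₛ T) D →
    ∣ T ∣ ≤ length D + m →
    count (λ K → isClique? G (suc r) K ×-dec K ⊆? T) (allSubsets n) ≤
    m C suc r + sum (map (λ v → degree G v C r) D)
  numCliques-⊆ r m [] _ T _ ∣T∣≤ = begin
    count (λ K → isClique? G (suc r) K ×-dec K ⊆? T) (allSubsets n)
      ≤⟨ count-subsets T (suc r) _ (λ ((∣K∣≡ , _) , K⊆T) → K⊆T , ∣K∣≡) ⟩
    ∣ T ∣ C suc r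
      ≤⟨ C-monoˡ-≤ (suc r) ∣T∣≤ ⟩
    m C suc r
      ≡⟨ +-identityʳ _ ⟨
    m C suc r + 0 ∎
    where open ≤-Reasoning
  numCliques-⊆ r m (v ∷ D) (v∉D ∷ uD) T (v∈T ∷ D⊆T) ∣T∣≤ = begin
    count (λ K → isClique? G (suc r) K ×-dec K ⊆? T) (allSubsets n)
      ≤⟨ count-∪ _ (λ K → isClique? G (suc r) K ×-dec v ∈ₛ? K)
           (λ K → isClique? G (suc r) K ×-dec K ⊆? (T - v)) split (allSubsets n) ⟩
    count (λ K → isClique? G (suc r) K ×-dec v ∈ₛ? K) (allSubsets n) +
    count (λ K → isClique? G (suc r) K ×-dec K ⊆? (T - v)) (allSubsets n)
      ≤⟨ +-mono-≤ (numCliques-∋ r v)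
           (numCliques-⊆ r m D uD (T - v)
             (All.zipWith (λ (v≢z , z∈T) → x∈p∧x≢y⇒x∈p-y z∈T (v≢z ∘ ≡.sym)) (v∉D , D⊆T))
             (s≤s⁻¹ (≤-trans (x∈p⇒∣p-x∣<∣p∣ v∈T) ∣T∣≤))) ⟩
    degree G v C r + (m C suc r + S)
      ≡⟨ +-assoc (degree G v C r) _ _ ⟨
    (degree G v C r + m C suc r) + S
      ≡⟨ cong (_+ S) (+-comm (degree G v C r) _) ⟩
    (m C suc r + degree G v C r) + S
      ≡⟨ +-assoc (m C suc r) _ _ ⟩
    m C suc r + (degree G v C r + S) ∎
    where
    open ≤-Reasoning
    S = sum (map (λ v → degree G v C r) D)
    split : ∀ {K} → IsClique G (suc r) K × K ⊆ T →
      (IsClique G (suc r) K × v ∈ₛ K) ⊎ (IsClique G (suc r) K × K ⊆ T - v)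
    split {K} (cl , K⊆T) with v ∈ₛ? K
    ... | yes v∈K = inj₁ (cl , v∈K)
    ... | no  v∉K = inj₂ (cl , λ {z} z∈K →
      x∈p∧x≢y⇒x∈p-y (K⊆T z∈K) λ z≡v → v∉K (subst (_∈ₛ K) z≡v z∈K))

  numCliques-≤ : ∀ r m (D : List (Fin n)) → Unique D → n ≤ length D + m →
    numCliques G (suc r) ≤ m C suc r + sum (map (λ v → degree G v C r) D)
  numCliques-≤ r m D uD n≤ = ≤-trans
    (count-mono (isClique? G (suc r)) (λ K → isClique? G (suc r) K ×-dec K ⊆? full)
      (λ cl → cl , λ _ → ∈⊤) (allSubsets n))
    (numCliques-⊆ r m D uD full (All.universal (λ _ → ∈⊤) D)
      (≤-trans (≤-reflexive (∣⊤∣≡n n)) n≤))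

-- Convexity of the bound

sum-map-≤ : ∀ (f : V → ℕ) b xs → All (λ x → f x ≤ b) xs → sum (map f xs) ≤ length xs * b
sum-map-≤ f b []       []         = z≤n
sum-map-≤ f b (x ∷ xs) (fx ∷ fxs) = +-mono-≤ fx (sum-map-≤ f b xs fxs)

-- Non-negative second differences, written without subtraction.
Convex : (ℕ → ℕ) → Set
Convex f = ∀ i → f (1 + i) + f (1 + i) ≤ f i + f (2 + i)

module _ {f : ℕ → ℕ} (cvx : Convex f) where

  convex-step : ∀ i → f i ≤ f (1 + i) → f (1 + i) ≤ f (2 + i)
  convex-step i le = +-cancelˡ-≤ (f (1 + i)) _ _ (≤-trans (cvx i) (+-monoˡ-≤ _ le))

  convex-mono : f 0 ≤ f 1 → ∀ {i j} → i ≤′ j → f i ≤ f j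
  convex-mono le ≤′-refl         = ≤-refl
  convex-mono le (≤′-step {j} p) = ≤-trans (convex-mono le p) (step j)
    where
    step : ∀ j → f j ≤ f (1 + j)
    step zero    = le
    step (suc j) = convex-step j (step j)

-- After a shift the left end is 0. If `f 0 ≤ f 1`, convexity makes `f` non-decreasing and the right
-- end dominates; otherwise the left end may be moved to 1, where the value is no larger.
convex-≤-ends : ∀ f → Convex f → ∀ {i j m} → i ≤ j → j ≤ m → f j ≤ f i ⊔ f m
convex-≤-ends f cvx {zero}  {zero}  _         j≤m       = m≤m⊔n (f 0) _
convex-≤-ends f cvx {zero}  {suc j} {suc m} _ (s≤s j≤m) with ≤-total (f 0) (f 1)
... | inj₁ le = ≤-trans (convex-mono {f} cvx le (≤⇒≤′ (s≤s j≤m))) (m≤n⊔m (f 0) _)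
... | inj₂ ge = ≤-trans (convex-≤-ends (f ∘ suc) (cvx ∘ suc) {0} z≤n j≤m) (⊔-monoˡ-≤ (f (suc m)) ge)
convex-≤-ends f cvx {suc i} (s≤s i≤j) (s≤s j≤m) = convex-≤-ends (f ∘ suc) (cvx ∘ suc) i≤j j≤m

convex-+ : ∀ {f g} → Convex f → Convex g → Convex (λ i → f i + g i)
convex-+ {f} {g} cf cg i = begin
  (f (1 + i) + g (1 + i)) + (f (1 + i) + g (1 + i)) ≡⟨ swap-+ (f (1 + i)) _ _ _ ⟩
  (f (1 + i) + f (1 + i)) + (g (1 + i) + g (1 + i)) ≤⟨ +-mono-≤ (cf i) (cg i) ⟩
  (f i + f (2 + i)) + (g i + g (2 + i))             ≡⟨ swap-+ (f i) _ _ _ ⟩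
  (f i + g i) + (f (2 + i) + g (2 + i))             ∎
  where
  open ≤-Reasoning
  open +-*-Solver
  swap-+ : ∀ a b c d → (a + b) + (c + d) ≡ (a + c) + (b + d)
  swap-+ = solve 4 (λ a b c d → (a :+ b) :+ (c :+ d) := (a :+ c) :+ (b :+ d)) ≡.refl

-- Reflection preserves convexity up to `c = N`. From there truncated subtraction makes the function
-- constant, and `f 0 ≤ f 1` is the convexity condition at the kink.
convex-∸ : ∀ f → f 0 ≤ f 1 → Convex f → ∀ N → Convex (λ c → f (N ∸ c))
convex-∸ f le cvx zero          c       = ≤-reflexive (cong (λ z → f z + f 0) (≡.sym (0∸n≡0 c)))
convex-∸ f le cvx (suc zero)    zero    = +-monoˡ-≤ (f 0) le
convex-∸ f le cvx (suc (suc N)) zero    = ≤-trans (cvx N) (≤-reflexive (+-comm (f N) _))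
convex-∸ f le cvx (suc N)       (suc c) = convex-∸ f le cvx N c

-- Product rule: the second difference of `i * f i` is `i` times that of `f` plus twice the
-- increment of `f` from `1 + i` to `2 + i`.
convex-scale : ∀ {f} → (∀ i → f i ≤ f (1 + i)) → Convex f → Convex (λ i → i * f i)
convex-scale {f} mono cvx i = begin
  (1 + i) * f (1 + i) + (1 + i) * f (1 + i)
    ≡⟨ lhs i (f (1 + i)) ⟩
  i * (f (1 + i) + f (1 + i)) + (f (1 + i) + f (1 + i))
    ≤⟨ +-mono-≤ (*-monoʳ-≤ i (cvx i)) (+-mono-≤ (mono (1 + i)) (mono (1 + i))) ⟩
  i * (f i + f (2 + i)) + (f (2 + i) + f (2 + i))
    ≡⟨ rhs i (f i) (f (2 + i)) ⟩
  i * f i + (2 + i) * f (2 + i) ∎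
  where
  open ≤-Reasoning
  open +-*-Solver
  lhs : ∀ i b → (1 + i) * b + (1 + i) * b ≡ i * (b + b) + (b + b)
  lhs = solve 2 (λ i b → (con 1 :+ i) :* b :+ (con 1 :+ i) :* b := i :* (b :+ b) :+ (b :+ b)) ≡.refl
  rhs : ∀ i a c → i * (a + c) + (c + c) ≡ i * a + (2 + i) * c
  rhs = solve 3 (λ i a c → i :* (a :+ c) :+ (c :+ c) := i :* a :+ (con 2 :+ i) :* c) ≡.refl

-- By Pascal's rule the first difference of `_C suc k` is `_C k`, which is non-decreasing.
C-convex : ∀ k → Convex (_C k)
C-convex zero    i = ≤-refl
C-convex (suc k) i = begin
  suc i C suc k + suc i C suc k
    ≡⟨ cong (_+ suc i C suc k) (nCk+nC[k+1]≡[n+1]C[k+1] i k) ⟨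
  (i C k + i C suc k) + suc i C suc k
    ≡⟨ cong (_+ suc i C suc k) (+-comm (i C k) _) ⟩
  (i C suc k + i C k) + suc i C suc k
    ≤⟨ +-monoˡ-≤ _ (+-monoʳ-≤ (i C suc k) (C-monoˡ-suc i k)) ⟩
  (i C suc k + suc i C k) + suc i C suc k
    ≡⟨ +-assoc (i C suc k) _ _ ⟩
  i C suc k + (suc i C k + suc i C suc k)
    ≡⟨ cong (i C suc k +_) (nCk+nC[k+1]≡[n+1]C[k+1] (suc i) k) ⟩
  i C suc k + suc (suc i) C suc k ∎
  where open ≤-Reasoning

convex-bound : ∀ N t r → Convex (λ c → (N ∸ c) C suc r + c * ((c + t) C r))
convex-bound N t r = convex-+ {λ c → (N ∸ c) C suc r}
  (convex-∸ (_C suc r) (C-monoˡ-suc 0 (suc r)) (C-convex (suc r)) N)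
  (convex-scale {λ c → (c + t) C r} (λ i → C-monoˡ-suc (i + t) r) (λ i → C-convex r (i + t)))

-- Walks, spiders and rotations

-- The list holds the vertices of the walk other than its starting vertex.
data Walk {V : Set} (E : Rel V 0ℓ) : V → List V → V → Set where
  nil  : Walk E a [] a
  step : E a b → Walk E b L c → Walk E a (b ∷ L) c

join : Walk E a L b → E b c → Walk E c M d → Walk E a (L ++ c ∷ M) d
join nil          e w′ = step e w′
join (step e′ w)  e w′ = step e′ (join w e w′)

-- Each list omits its own starting vertex, so only the lists completed by their starts are
-- permutations of each other.
reverse-walk : Symmetric E → Walk E a L b → ∃ λ R → Walk E b R a × a ∷ L ↭ b ∷ R
reverse-walk sy nil = [] , nil , ↭-refl
reverse-walk {a = a} {b = c} sy (step {b = b} e w) with reverse-walk sy w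
... | R , w′ , p = R ++ [ a ] , join w′ (sy e) nil , ↭-trans (prep a p) (∷↭∷ʳ a (c ∷ R))

last-∈ : Walk E a L b → b ∈ a ∷ L
last-∈ nil        = here ≡.refl
last-∈ (step _ w) = there (last-∈ w)

-- A consecutive pair from, to on the walk with P from and Q to: the place where a
-- rotation cuts the walk open.
record Crossing (E : Rel V 0ℓ) (P Q : Pred V 0ℓ) (a : V) (L : List V) (b : V) : Set where
  constructor crossing
  field
    {before after} : List V
    {from to}      : V
    walk₁          : Walk E a before from
    Pfrom          : P from
    Qto            : Q to
    walk₂          : Walk E to after b
    split          : L ≡ before ++ to ∷ after

-- Pigeonhole: without a crossing, each of the `length L` consecutive pairs contributes at most one
-- to the two counts. The last vertex starts no pair, which leaves the term `count P? [ b ]`.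
crossing⊎count : (P? : Decidable P) (Q? : Decidable Q) → Walk E a L b →
  Crossing E P Q a L b ⊎ count P? (a ∷ L) + count Q? L ≤ length L + count P? [ b ]
crossing⊎count P? Q? nil = inj₂ (≤-reflexive (+-identityʳ _))
crossing⊎count {a = a} P? Q? (step {b = b} {L = L} e w) with crossing⊎count P? Q? w
... | inj₁ (crossing w₁ pc qd w₂ ≡.refl) = inj₁ (crossing (step e w₁) pc qd w₂ ≡.refl)
... | inj₂ le with P? a | Q? b
...   | yes p | yes q = inj₁ (crossing nil p q w ≡.refl)
...   | yes _ | no  _ = inj₂ (s≤s le)
...   | no  _ | yes _ = inj₂ (≤-trans (≤-reflexive (+-suc (count P? (b ∷ L)) _)) (s≤s le))
...   | no  _ | no  _ = inj₂ (m≤n⇒m≤1+n le)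

-- Paths from u to the vertices of the first list; the second list is the concatenation
-- of their vertex lists without u.  Disjointness is imposed separately, as u ∷ M ↭ allFin n.
data Spider {V : Set} (E : Rel V 0ℓ) (u : V) : List V → List V → Set where
  nil  : Spider E u [] []
  cons : Walk E u L a → Spider E u ts M → Spider E u (a ∷ ts) (L ++ M)

-- A rotation acts on a broken leg that has been brought to the front; this restores the prescribed
-- order of the targets.
spider-↭ : ts ↭ ts′ → Spider E u ts M → ∃ λ M′ → Spider E u ts′ M′ × M ↭ M′
spider-↭ refl         S = _ , S , ↭-refl
spider-↭ (prep x p)   (cons {L = L} w S) with spider-↭ p S
... | M′ , S′ , q = L ++ M′ , cons w S′ , ++⁺ˡ L q
spider-↭ (swap x y p) (cons {L = L} w (cons {L = L′} w′ S)) with spider-↭ p S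
... | M′ , S′ , q = L′ ++ L ++ M′ , cons w′ (cons w S′) ,
  ↭-trans (shifts L L′) (++⁺ˡ L′ (++⁺ˡ L q))
spider-↭ (trans p q)  S with spider-↭ p S
... | M′ , S′ , r with spider-↭ q S′
...   | M″ , S″ , r′ = M″ , S″ , ↭-trans r r′

exchange-↭ : ∀ (A B X Y M : List V) → (A ++ B) ++ (X ++ Y) ++ M ↭ (X ++ B) ++ (A ++ Y) ++ M
exchange-↭ A B X Y M
  rewrite ++-assoc A B ((X ++ Y) ++ M) | ++-assoc X Y M
        | ++-assoc X B ((A ++ Y) ++ M) | ++-assoc A Y M = begin
  A ++ B ++ X ++ Y ++ M ↭⟨ ++⁺ˡ A (shifts B X) ⟩
  A ++ X ++ B ++ Y ++ M ↭⟨ shifts A X ⟩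
  X ++ A ++ B ++ Y ++ M ↭⟨ ++⁺ˡ X (shifts A B) ⟩
  X ++ B ++ A ++ Y ++ M ∎
  where open PermutationReasoning

Unique-resp-↭ : {xs ys : List V} → xs ↭ ys → Unique xs → Unique ys
Unique-resp-↭ {V} p = Setoid.Unique-resp-↭ (↭⇒↭ₛ p)
  where import Data.List.Relation.Binary.Permutation.Setoid.Properties (≡.setoid V) as Setoid

unique-++-disjoint : ∀ {x : V} L → Unique (L ++ M) → x ∈ L → x ∉ M
unique-++-disjoint (_ ∷ L) (x≢ ∷ _) (here ≡.refl) x∈M = All.lookup x≢ (∈-++⁺ʳ L x∈M) ≡.refl
unique-++-disjoint (_ ∷ L) (_ ∷ un) (there x∈L)   x∈M = unique-++-disjoint L un x∈L x∈M

module _ {n} (H : Graph n) where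
  open Graph H

  module _ {u x y v} {A B : List (Fin n)} (w₁ : Walk _~_ u A x) (w₂ : Walk _~_ y B v) where

    -- A leg u ⋯ c d ⋯ a with y ~ c and x ~ d yields the legs u ⋯ c y ⋯ v and u ⋯ x d ⋯ a.
    swap-ends : ∀ {ts M} → Spider _~_ u ts M →
      (∃ λ M′ → Spider _~_ u (v ∷ ts) M′ × M′ ↭ (A ++ y ∷ B) ++ M) ⊎
      count (y ~?_) M + count (x ~?_) M + length ts * count (y ~?_) [ u ] ≤ length M + length ts
    swap-ends nil = inj₂ z≤n
    swap-ends (cons {L = L} {a = a} {ts = ts} {M = M} w S) with crossing⊎count (y ~?_) (x ~?_) w
    ... | inj₁ (crossing {X} {Y} {c} {d} w₃ y~c x~d w₄ ≡.refl) = inj₁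
      (_ , cons (join w₃ (sym y~c) w₂) (cons (join w₁ x~d w₄) S) , exchange-↭ X (y ∷ B) A (d ∷ Y) M)
    ... | inj₂ le with swap-ends S
    ...   | inj₁ (_ , cons {L = L′} w′ S′ , p) = inj₁
      (_ , cons w′ (cons w S′) , ↭-trans (shifts L′ L) (↭-trans (++⁺ˡ L p) (shifts L (A ++ y ∷ B))))
    ...   | inj₂ le′ = inj₂ (begin
      count (y ~?_) (L ++ M) + count (x ~?_) (L ++ M) + suc (length ts) * yu
        ≡⟨ cong₂ (λ p q → p + q + suc (length ts) * yu)
             (count-++ (y ~?_) L M) (count-++ (x ~?_) L M) ⟩
      (yL + yM) + (xL + xM) + suc (length ts) * yu
        ≡⟨ rearrange yL yM xL xM (length ts) yu ⟩
      ((yu + yL) + xL) + (yM + xM + length ts * yu)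
        ≤⟨ +-mono-≤ (≤-trans (≤-reflexive (cong (_+ xL) (≡.sym (count-++ (y ~?_) [ u ] L)))) le) le′ ⟩
      (length L + count (y ~?_) [ a ]) + (length M + length ts)
        -- A possible edge from `y` to the target costs one per leg; these units produce the `t` in
        -- the threshold.
        ≤⟨ +-monoˡ-≤ _ (+-monoʳ-≤ (length L) (length-filter (y ~?_) [ a ])) ⟩
      (length L + 1) + (length M + length ts)
        ≡⟨ rearrange′ (length L) (length M) (length ts) ⟩
      (length L + length M) + suc (length ts)
        ≡⟨ cong (_+ suc (length ts)) (length-++ L) ⟨
      length (L ++ M) + suc (length ts) ∎)
      where
      open ≤-Reasoning
      open +-*-Solver
      yu = count (y ~?_) [ u ]
      yL = count (y ~?_) L
      yM = count (y ~?_) M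
      xL = count (x ~?_) L
      xM = count (x ~?_) M
      rearrange : ∀ a b c d t e → (a + b) + (c + d) + suc t * e ≡ ((e + a) + c) + (b + d + t * e)
      rearrange = solve 6 (λ a b c d t e → (a :+ b) :+ (c :+ d) :+ (con 1 :+ t) :* e :=
        ((e :+ a) :+ c) :+ (b :+ d :+ t :* e)) ≡.refl
      rearrange′ : ∀ a b t → (a + 1) + (b + t) ≡ (a + b) + suc t
      rearrange′ = solve 3 (λ a b t → (a :+ con 1) :+ (b :+ t) := (a :+ b) :+ (con 1 :+ t)) ≡.refl

    count-irrefl : ∀ z → count (z ~?_) [ z ] ≡ 0
    count-irrefl z with z ~? z
    ... | yes z~z = contradiction z~z (irrefl ≡.refl)
    ... | no  _   = ≡.refl

    degree-↭ : ∀ z → u ∷ (A ++ y ∷ B) ++ M ↭ allFin n → degree H z ≡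
      count (z ~?_) (u ∷ A) + (count (z ~?_) (y ∷ B) + count (z ~?_) M)
    degree-↭ {M} z p = begin
      degree H z
        ≡⟨ ↭-length (filter-↭ (z ~?_) p) ⟨
      count (z ~?_) (u ∷ (A ++ y ∷ B) ++ M)
        ≡⟨ cong (λ X → count (z ~?_) (u ∷ X)) (++-assoc A (y ∷ B) M) ⟩
      count (z ~?_) ((u ∷ A) ++ (y ∷ B) ++ M)
        ≡⟨ count-++ (z ~?_) (u ∷ A) _ ⟩
      count (z ~?_) (u ∷ A) + count (z ~?_) ((y ∷ B) ++ M)
        ≡⟨ cong (count (z ~?_) (u ∷ A) +_) (count-++ (z ~?_) (y ∷ B) M) ⟩
      count (z ~?_) (u ∷ A) + (count (z ~?_) (y ∷ B) + count (z ~?_) M) ∎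
      where open ≡.≡-Reasoning

    -- The walks w₁ and w₂ are what remains of a leg u ⋯ x y ⋯ v after removing xy.  The cut
    -- c d lies in u ⋯ x (new leg u ⋯ c x ⋯ d y ⋯ v), in y ⋯ v (new leg u ⋯ x c ⋯ y d ⋯ v),
    -- or in another leg.  Without any cut, summing the three counts gives d(x) + d(y) ≤ n + t − 2.
    rotate : ∀ {ts M} → Spider _~_ u ts M → 1 ≤ length ts → u ∷ (A ++ y ∷ B) ++ M ↭ allFin n →
      n + suc (length ts) ≤ suc (degree H x + degree H y) →
      ∃ λ M′ → Spider _~_ u (v ∷ ts) M′ × M′ ↭ (A ++ y ∷ B) ++ M
    rotate {ts} {M} S 1≤ p big
      with crossing⊎count (x ~?_) (y ~?_) w₁ | crossing⊎count (x ~?_) (y ~?_) w₂ | swap-ends S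
    ... | inj₁ (crossing {A₁} {A₂} {c} {d} w₃ x~c y~d w₄ ≡.refl) | _ | _
        with reverse-walk sym w₄
    ...   | R , w₅ , q = _ , cons (join w₃ (sym x~c) (join w₅ (sym y~d) w₂)) S ,
      ++⁺ʳ M (↭-trans (++⁺ˡ A₁ (++⁺ʳ (y ∷ B) (↭-sym q)))
        (↭-reflexive (≡.sym (++-assoc A₁ (d ∷ A₂) (y ∷ B)))))
    rotate {ts} {M} S 1≤ p big
        | inj₂ _ | inj₁ (crossing {B₁} {B₂} {c} {d} w₃ x~c y~d w₄ ≡.refl) | _
        with reverse-walk sym w₃
    ...   | R , w₅ , q = _ , cons (join w₁ x~c (join w₅ y~d w₄)) S ,
      ++⁺ʳ M (++⁺ˡ A (++⁺ʳ (d ∷ B₂) (↭-sym q)))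
    rotate S 1≤ p big | inj₂ _ | inj₂ _ | inj₁ found = found
    rotate {ts} {M} S 1≤ p big | inj₂ le₁ | inj₂ le₂ | inj₂ le₃ =
      contradiction (≤-trans big (s≤s sum≤)) (<⇒≱ (≤-reflexive (≡.sym total)))
      where
      k  = length ts
      lA = length A
      lB = length B
      lM = length M
      X₁ = count (x ~?_) (u ∷ A)
      X₂ = count (x ~?_) (y ∷ B)
      X₃ = count (x ~?_) M
      yu = count (y ~?_) [ u ]
      Y₁ = count (y ~?_) A
      Y₂ = count (y ~?_) B
      Y₃ = count (y ~?_) M
      open +-*-Solver
      -- The count along `w₁` leaves out the adjacency of `y` to `u`, whereas every other leg starts
      -- with `u` and counts it. One such leg suffices to cover it.
      yu≤ : yu ≤ k * yu
      yu≤ = ≤-trans (≤-reflexive (≡.sym (*-identityˡ yu))) (*-monoˡ-≤ yu 1≤)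
      eqY₁ : count (y ~?_) (u ∷ A) ≡ yu + Y₁
      eqY₁ = count-++ (y ~?_) [ u ] A
      eqY₂ : count (y ~?_) (y ∷ B) ≡ Y₂
      eqY₂ = ≡.trans (count-++ (y ~?_) [ y ] B) (cong (_+ Y₂) (count-irrefl y))
      rearrange : ∀ a b c e f g h → (a + (b + c)) + ((e + f) + (g + h)) ≡ (a + f) + (b + g) + (h + c + e)
      rearrange = solve 7 (λ a b c e f g h → (a :+ (b :+ c)) :+ ((e :+ f) :+ (g :+ h)) :=
        (a :+ f) :+ (b :+ g) :+ (h :+ c :+ e)) ≡.refl
      sum≤ : degree H x + degree H y ≤ lA + (lB + 1) + (lM + k)
      sum≤ = begin
        degree H x + degree H y
          ≡⟨ cong₂ _+_ (degree-↭ x p) (≡.trans (degree-↭ y p)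
               (cong₂ _+_ eqY₁ (cong (_+ Y₃) eqY₂))) ⟩
        (X₁ + (X₂ + X₃)) + ((yu + Y₁) + (Y₂ + Y₃))
          ≡⟨ rearrange X₁ X₂ X₃ yu Y₁ Y₂ Y₃ ⟩
        (X₁ + Y₁) + (X₂ + Y₂) + (Y₃ + X₃ + yu)
          -- Leftovers at the last vertices: none on u ⋯ x, since `x` is not adjacent to itself, and
          -- at most one on y ⋯ v; those of the other legs are already included in `le₃`.
          ≤⟨ +-mono-≤ (+-mono-≤
               (≤-trans le₁ (≤-reflexive (≡.trans (cong (lA +_) (count-irrefl x)) (+-identityʳ lA))))
               (≤-trans le₂ (+-monoʳ-≤ lB (length-filter (x ~?_) [ v ]))))
               (≤-trans (+-monoʳ-≤ (Y₃ + X₃) yu≤) le₃) ⟩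
        lA + (lB + 1) + (lM + k) ∎
        where open ≤-Reasoning
      total : n + suc k ≡ suc (suc (lA + (lB + 1) + (lM + k)))
      total = begin
        n + suc k
          ≡⟨ cong (_+ suc k) (≡.trans (≡.sym (length-tabulate id)) (≡.sym (↭-length p))) ⟩
        suc (length ((A ++ y ∷ B) ++ M)) + suc k
          ≡⟨ cong (λ l → suc l + suc k) (≡.trans (length-++ (A ++ y ∷ B)) (cong (_+ lM) (length-++ A))) ⟩
        suc (lA + suc lB + lM) + suc k
          ≡⟨ solve 4 (λ a b m k → con 1 :+ (a :+ (con 1 :+ b) :+ m) :+ (con 1 :+ k) :=
               con 2 :+ (a :+ (b :+ con 1) :+ (m :+ k))) ≡.refl lA lB lM k ⟩
        suc (suc (lA + (lB + 1) + (lM + k))) ∎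
        where
        open ≡.≡-Reasoning

-- Eliminating an added edge from a spider

module _ {E Bad : Rel V 0ℓ} where

  E⁺ : Rel V 0ℓ
  E⁺ a b = E a b ⊎ Bad a b

  -- The cut is made at the first bad step. That `walk₂` contains no further bad step needs distinct
  -- vertices and is shown later.
  record BrokenWalk (a : V) (L : List V) (b : V) : Set where
    constructor broken
    field
      {A B}  : List V
      {p q}  : V
      walk₁  : Walk E a A p
      bad    : Bad p q
      walk₂  : Walk E⁺ q B b
      split  : L ≡ A ++ q ∷ B

  walk⊎broken : Walk E⁺ a L b → Walk E a L b ⊎ BrokenWalk a L b
  walk⊎broken nil               = inj₁ nil
  walk⊎broken (step (inj₂ e) w) = inj₂ (broken nil e w ≡.refl)
  walk⊎broken (step (inj₁ e) w) with walk⊎broken w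
  ... | inj₁ w′                         = inj₁ (step e w′)
  ... | inj₂ (broken w₁ bad w₂ ≡.refl) = inj₂ (broken (step e w₁) bad w₂ ≡.refl)

  record BrokenSpider (u : V) (ts M : List V) : Set where
    constructor broken
    field
      {A B M₁ ts₁} : List V
      {p q v}      : V
      walk₁        : Walk E u A p
      bad          : Bad p q
      walk₂        : Walk E⁺ q B v
      rest         : Spider E⁺ u ts₁ M₁
      targets      : ts ↭ v ∷ ts₁
      split        : M ↭ (A ++ q ∷ B) ++ M₁

  spider⊎broken : Spider E⁺ u ts M → Spider E u ts M ⊎ BrokenSpider u ts M
  spider⊎broken nil = inj₁ nil
  spider⊎broken (cons {L = L} {a = a} w S) with walk⊎broken w
  ... | inj₂ (broken w₁ bad w₂ ≡.refl) = inj₂ (broken w₁ bad w₂ S ↭-refl ↭-refl)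
  ... | inj₁ w′ with spider⊎broken S
  ...   | inj₁ S′ = inj₁ (cons w′ S′)
  ...   | inj₂ (broken {A} {B} {q = q} {v} w₁ bad w₂ S′ r s) = inj₂
    (broken w₁ bad w₂ (cons w S′) (↭-trans (prep a r) (swap a v ↭-refl))
      (↭-trans (++⁺ˡ L s) (shifts L (A ++ q ∷ B))))

  -- A spider uses the new edge at most once, since its vertices are distinct: the part
  -- after the first use avoids one end of the edge.
  module _ {z} (touches : ∀ {a b} → Bad a b → z ≡ a ⊎ z ≡ b) where

    walk-avoiding : Walk E⁺ a L b → z ∉ a ∷ L → Walk E a L b
    walk-avoiding nil                 z∉ = nil
    walk-avoiding (step (inj₁ e)   w) z∉ = step e (walk-avoiding w (z∉ ∘ there))
    walk-avoiding (step (inj₂ bad) w) z∉ =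
      contradiction ([ here , there ∘ here ]′ (touches bad)) z∉

    spider-avoiding : Spider E⁺ u ts M → z ∉ u ∷ M → Spider E u ts M
    spider-avoiding nil              z∉ = nil
    spider-avoiding {u = u} (cons {L = L} w S) z∉ = cons
      (walk-avoiding w (z∉ ∘ ∈-++⁺ˡ))
      (spider-avoiding S λ { (here e) → z∉ (here e) ; (there z∈) → z∉ (there (∈-++⁺ʳ L z∈)) })

module _ {n} (H : Graph n) {Bad : Rel (Fin n) 0ℓ} where
  open Graph H

  -- The first hypothesis says that `Bad` is a single undirected edge: each end of a bad pair is an
  -- end of every bad pair. After the first use of that edge, the remainder of the spider therefore
  -- lies in `H`, and `rotate` applies.
  remove-edge : ∀ {u ts M} →
    (∀ {p q} → Bad p q → (∀ {a b} → Bad a b → p ≡ a ⊎ p ≡ b) × (∀ {a b} → Bad a b → q ≡ a ⊎ q ≡ b)) →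
    (∀ {p q} → Bad p q → n + length ts ≤ suc (degree H p + degree H q)) →
    2 ≤ length ts → u ∷ M ↭ allFin n → Spider (λ a b → a ~ b ⊎ Bad a b) u ts M →
    ∃ λ M′ → Spider _~_ u ts M′ × M′ ↭ M
  remove-edge {u} {ts} {M} one-edge big 2≤ perm S with spider⊎broken {E = _~_} {Bad = Bad} S
  ... | inj₁ S′ = M , S′ , ↭-refl
  ... | inj₂ (broken {A} {B} {M₁} {ts₁} {p} {q} {v} w₁ bad w₂ S₁ r s) = repair
    (rotate H w₁ w₂′ S₁′
      (s≤s⁻¹ (≤-trans 2≤ (≤-reflexive (↭-length r)))) perm′
      (≤-trans (≤-reflexive (cong (n +_) (≡.sym (↭-length r)))) (big bad)))
    where
    repair : (∃ λ M₂ → Spider _~_ u (v ∷ ts₁) M₂ × M₂ ↭ (A ++ q ∷ B) ++ M₁) →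
      ∃ λ M₃ → Spider _~_ u ts M₃ × M₃ ↭ M
    repair (M₂ , S₂ , s₂) with spider-↭ (↭-sym r) S₂
    ... | M₃ , S₃ , s₃ = M₃ , S₃ , ↭-trans (↭-sym s₃) (↭-trans s₂ (↭-sym s))
    perm′ : u ∷ (A ++ q ∷ B) ++ M₁ ↭ allFin n
    perm′ = ↭-trans (prep u (↭-sym s)) perm
    un : Unique ((u ∷ A ++ q ∷ B) ++ M₁)
    un = Unique-resp-↭ (↭-sym perm′) (Unique.allFin⁺ n)
    un′ : Unique ((u ∷ A) ++ (q ∷ B) ++ M₁)
    un′ = subst (Unique ∘ (u ∷_)) (++-assoc A (q ∷ B) M₁) un
    w₂′ : Walk _~_ q B v
    w₂′ = walk-avoiding (proj₁ (one-edge bad)) w₂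
      (unique-++-disjoint (u ∷ A) un′ (last-∈ w₁) ∘ ∈-++⁺ˡ)
    q∈ : q ∈ A ++ q ∷ B
    q∈ = ∈-++⁺ʳ A (here ≡.refl)
    -- The end avoided by the other legs is `q`: the end `p` may be `u` itself, which lies on every
    -- leg.
    S₁′ : Spider _~_ u ts₁ M₁
    S₁′ = spider-avoiding (proj₂ (one-edge bad)) S₁ λ
      { (here ≡.refl) → unique-++-disjoint [ u ] un (here ≡.refl) (∈-++⁺ˡ q∈)
      ; (there q∈M₁)  → unique-++-disjoint (u ∷ A ++ q ∷ B) un (there q∈) q∈M₁ }

-- Lists of distinct vertices and systems of disjoint paths

∈-∷⁻ : ∀ {z x : V} {ys} → x ≢ z → z ∈ x ∷ ys → z ∈ ys
∈-∷⁻ x≢z (here z≡x) = contradiction (≡.sym z≡x) x≢z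
∈-∷⁻ _   (there z∈) = z∈

extend-↭ : {xs ys : List V} → Unique xs → (∀ {z} → z ∈ xs → z ∈ ys) → ∃ λ R → xs ++ R ↭ ys
extend-↭ {xs = []}     {ys} _         _   = ys , ↭-refl
extend-↭ {xs = x ∷ xs}      (x∉ ∷ un) sub with ∈-∃++ (sub (here ≡.refl))
... | as , bs , ≡.refl
    with R , p ← extend-↭ {ys = as ++ bs} un
           (λ z∈ → ∈-∷⁻ (All.lookup x∉ z∈) (∈-resp-↭ (shift x as bs) (sub (there z∈))))
    = R , ↭-trans (prep x p) (↭-sym (shift x as bs))

count-mono-< : (P? : Decidable P) (Q? : Decidable Q) → (∀ {x} → P x → Q x) →
  ∀ {z xs} → z ∈ xs → Q z → ¬ P z → count P? xs < count Q? xs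
count-mono-< P? Q? P⊆Q {xs = x ∷ xs} (here ≡.refl) q ¬p with P? x | Q? x
... | yes p | _     = contradiction p ¬p
... | no _  | no ¬q = contradiction q ¬q
... | no _  | yes _ = s≤s (count-mono P? Q? P⊆Q xs)
count-mono-< P? Q? P⊆Q {xs = x ∷ xs} (there z∈) q ¬p
  with ih ← count-mono-< P? Q? P⊆Q z∈ q ¬p | P? x | Q? x
... | no _  | no _  = ih
... | no _  | yes _ = m≤n⇒m≤1+n ih
... | yes _ | yes _ = s≤s ih
... | yes p | no ¬q = contradiction (P⊆Q p) ¬q

count-≡-≤1 : ∀ {n} (w : Fin n) xs → Unique xs → count (_≟ w) xs ≤ 1
count-≡-≤1 w []       _ = z≤n
count-≡-≤1 w (x ∷ xs) (x∉ ∷ un) with x ≟ w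
... | yes ≡.refl = s≤s (≤-reflexive (cong length
  (filter-none (_≟ w) (All.map (λ w≢ z≡ → w≢ (≡.sym z≡)) x∉))))
... | no  _ = count-≡-≤1 w xs un

record PathSystem {t} (E : Rel V 0ℓ) (u : V) (v : Fin t → V) (M : List V) : Set where
  field
    inner    : Fin t → List V
    walk     : ∀ i → Walk E u (inner i) (v i)
    unique   : ∀ i → Unique (inner i)
    within   : ∀ i {z} → z ∈ inner i → z ∈ M
    covers   : ∀ {z} → z ∈ M → ∃ λ i → z ∈ inner i
    disjoint : ∀ i j → i ≢ j → ∀ {z} → z ∈ inner i → z ∉ inner j

unique-++⁻ : ∀ {M : List V} L → Unique (L ++ M) → Unique L × Unique M
unique-++⁻ []      un        = [] , un
unique-++⁻ (x ∷ L) (x∉ ∷ un) with unique-++⁻ L un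
... | uL , uM = All.++⁻ˡ L x∉ ∷ uL , uM

path-system : ∀ {t u M} (v : Fin t → V) → Spider E u (tabulate v) M → Unique M → PathSystem E u v M
path-system {t = zero} v nil _ = record
  { inner = λ (); walk = λ (); unique = λ (); within = λ (); covers = λ (); disjoint = λ () }
path-system {E = E} {t = suc t} {u} v (cons {L = L} {M = M} w S) un = record
  { inner = inner; walk = walk; unique = unique; within = within; covers = covers; disjoint = disjoint }
  where
  module S = PathSystem (path-system (v ∘ suc) S (proj₂ (unique-++⁻ L un)))
  inner : Fin (suc t) → List _
  inner zero    = L
  inner (suc i) = S.inner i
  walk : ∀ i → Walk E u (inner i) (v i)
  walk zero    = w
  walk (suc i) = S.walk i
  unique : ∀ i → Unique (inner i)
  unique zero    = proj₁ (unique-++⁻ L un)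
  unique (suc i) = S.unique i
  within : ∀ i {z} → z ∈ inner i → z ∈ L ++ M
  within zero    z∈ = ∈-++⁺ˡ z∈
  within (suc i) z∈ = ∈-++⁺ʳ L (S.within i z∈)
  covers : ∀ {z} → z ∈ L ++ M → ∃ λ i → z ∈ inner i
  covers z∈ with ∈-++⁻ L z∈
  ... | inj₁ z∈L = zero , z∈L
  ... | inj₂ z∈M with S.covers z∈M
  ...   | i , z∈i = suc i , z∈i
  disjoint : ∀ i j → i ≢ j → ∀ {z} → z ∈ inner i → z ∉ inner j
  disjoint zero    zero    i≢j z∈ z∈′ = i≢j ≡.refl
  disjoint zero    (suc j) i≢j z∈ z∈′ = unique-++-disjoint L un z∈ (S.within j z∈′)
  disjoint (suc i) zero    i≢j z∈ z∈′ = unique-++-disjoint L un z∈′ (S.within i z∈)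
  disjoint (suc i) (suc j) i≢j z∈ z∈′ = S.disjoint i j (i≢j ∘ cong suc) z∈ z∈′

-- Closure

SpanningSpider : ∀ {n} → Graph n → Fin n → List (Fin n) → Set
SpanningSpider {n} H u ts = ∃ λ M → Spider (Graph._~_ H) u ts M × u ∷ M ↭ allFin n

module _ {n} (H : Graph n) where
  open Graph H

  toStar : ∀ {a L b} → Walk _~_ a L b → Star _~_ a b
  toStar nil        = ε
  toStar (step e w) = e ◅ toStar w

  vertices-toStar : ∀ {a L b} (w : Walk _~_ a L b) → vertices H (toStar w) ≡ a ∷ L
  vertices-toStar nil        = ≡.refl
  vertices-toStar (step e w) = cong (_ ∷_) (vertices-toStar w)

  coverable : ∀ {t} → (∀ u (v : Fin (suc t) → Fin n) → Injective _≡_ _≡_ v → (∀ i → v i ≢ u) →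
    SpanningSpider H u (tabulate v)) → OneToManyDisjointPathCoverable H (suc t)
  coverable {t} spider u v inj v≢u with spider u v inj v≢u
  ... | M , S , perm with Unique-resp-↭ (↭-sym perm) (Unique.allFin⁺ n)
  ...   | u∉M ∷ uM = (λ i → toStar (walk i) , subst Unique (≡.sym (vertices-toStar (walk i)))
            (All.tabulate (λ z∈ → All.lookup u∉M (within i z∈)) ∷ unique i))
        , covered , meet
    where
    open PathSystem (path-system v S uM)
    ∈⁺ : ∀ i {x} → x ∈ u ∷ inner i → x ∈ vertices H (toStar (walk i))
    ∈⁺ i = subst (_ ∈_) (≡.sym (vertices-toStar (walk i)))
    ∈⁻ : ∀ i {x} → x ∈ vertices H (toStar (walk i)) → x ∈ u ∷ inner i
    ∈⁻ i = subst (_ ∈_) (vertices-toStar (walk i))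
    covered : ∀ x → ∃ λ i → x ∈ vertices H (toStar (walk i))
    covered x with ∈-resp-↭ (↭-sym perm) (∈-allFin x)
    -- The vertex `u` is in no inner list but starts every path; path `zero` exists because there
    -- are `suc t` of them.
    ... | here x≡u = zero , ∈⁺ zero (here x≡u)
    ... | there x∈ with covers x∈
    ...   | i , x∈i = i , ∈⁺ i (there x∈i)
    meet : ∀ i j → i ≢ j → ∀ x → x ∈ vertices H (toStar (walk i)) → x ∈ vertices H (toStar (walk j)) → x ≡ u
    meet i j i≢j x x∈i x∈j with ∈⁻ i x∈i | ∈⁻ j x∈j
    ... | here x≡u  | _         = x≡u
    ... | there _   | here x≡u  = x≡u
    ... | there x∈i | there x∈j = contradiction x∈j (disjoint i j i≢j x∈i)

  module _ (complete : ∀ a b → a ≢ b → a ~ b) where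

    complete-walk : ∀ {a b} L → Unique (a ∷ L ++ [ b ]) → Walk _~_ a (L ++ [ b ]) b
    complete-walk []      ((a≢b ∷ _) ∷ _)  = step (complete _ _ a≢b) nil
    complete-walk (c ∷ L) ((a≢c ∷ _) ∷ un) = step (complete _ _ a≢c) (complete-walk L un)

    complete-star : ∀ {u ts} → All (u ≢_) ts → Spider _~_ u ts ts
    complete-star []         = nil
    complete-star (u≢a ∷ u∉) = cons (step (complete _ _ u≢a) nil) (complete-star u∉)

    -- Every target in `ts` is reached by a single edge, and the leg to `v` collects all remaining
    -- vertices.
    complete-spider : ∀ {u v ts} → Unique (u ∷ v ∷ ts) → SpanningSpider H u (v ∷ ts)
    complete-spider {u} {v} {ts} un@((_ ∷ u∉ts) ∷ _)
      with extend-↭ {ys = allFin n} un (λ _ → ∈-allFin _)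
    ... | R , p = (R ++ [ v ]) ++ ts
        , cons (complete-walk R (proj₁ (unique-++⁻ (u ∷ R ++ [ v ])
            (Unique-resp-↭ (↭-sym perm) (Unique.allFin⁺ n))))) (complete-star u∉ts)
        , perm
      where
      perm : u ∷ (R ++ [ v ]) ++ ts ↭ allFin n
      perm = ↭-trans (prep u (↭-trans (↭-reflexive (++-assoc R [ v ] ts)) (++-comm R (v ∷ ts)))) p

  NonAdjacent : Fin n → Fin n → Set
  NonAdjacent x y = x ≢ y × ¬ x ~ y

  nonAdjacent? : ∀ x y → Dec (NonAdjacent x y)
  nonAdjacent? x y = ¬? (x ≟ y) ×-dec ¬? (x ~? y)

  pairs : List (Fin n × Fin n)
  pairs = cartesianProduct (allFin n) (allFin n)

  ∈-pairs : ∀ x y → (x , y) ∈ pairs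
  ∈-pairs x y = ∈-cartesianProduct⁺ (∈-allFin x) (∈-allFin y)

  -- The measure that makes the closure process terminate.
  missing : ℕ
  missing = count (uncurry nonAdjacent?) pairs

  -- For `m = n + t` this is d(x) + d(y) ≤ n + t - 2, the negation of the rotation condition, stated
  -- without subtraction.
  Closed : ℕ → Set
  Closed m = ∀ x y → NonAdjacent x y → suc (degree H x + degree H y) < m

  maximal-nonAdjacent : ∀ x y → NonAdjacent x y → ∃₂ λ x y → NonAdjacent x y ×
    degree H x ≤ degree H y × (∀ a b → NonAdjacent a b → degree H a + degree H b ≤ degree H x + degree H y)
  maximal-nonAdjacent x₀ y₀ na₀ = orient (≤-total (degree H x) (degree H y))
    where
    degrees : Fin n × Fin n → ℕ
    degrees (a , b) = degree H a + degree H b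
    candidates : List (Fin n × Fin n)
    candidates = filter (uncurry nonAdjacent?) pairs
    x y : Fin n
    x = proj₁ (argmax degrees (x₀ , y₀) candidates)
    y = proj₂ (argmax degrees (x₀ , y₀) candidates)
    -- The default `(x₀ , y₀)` of `argmax` is itself non-adjacent, so the result is so in every
    -- case.
    na : NonAdjacent x y
    na = argmax-all degrees {P = uncurry NonAdjacent} na₀ (All.all-filter (uncurry nonAdjacent?) pairs)
    max : ∀ a b → NonAdjacent a b → degree H a + degree H b ≤ degree H x + degree H y
    max a b na′ = All.lookup (f[xs]≤f[argmax] {f = degrees} (x₀ , y₀) candidates)
      (∈-filter⁺ (uncurry nonAdjacent?) (∈-pairs a b) na′)
    orient : degree H x ≤ degree H y ⊎ degree H y ≤ degree H x →
      ∃₂ λ x y → NonAdjacent x y × degree H x ≤ degree H y ×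
        (∀ a b → NonAdjacent a b → degree H a + degree H b ≤ degree H x + degree H y)
    orient (inj₁ x≤y) = x , y , na , x≤y , max
    orient (inj₂ y≤x) = y , x , (proj₁ na ∘ ≡.sym , proj₂ na ∘ sym) , y≤x , λ a b na′ →
      ≤-trans (max a b na′) (≤-reflexive (+-comm (degree H x) (degree H y)))

infix 4 _⊑_
_⊑_ : ∀ {n} → Graph n → Graph n → Set
G ⊑ H = ∀ {a b} → Graph._~_ G a b → Graph._~_ H a b

degree-mono : ∀ {n} (G H : Graph n) → G ⊑ H → ∀ z → degree G z ≤ degree H z
degree-mono {n} G H G⊑H z = count-mono (Graph._~?_ G z) (Graph._~?_ H z) G⊑H (allFin n)

module _ {n} (H : Graph n) (p q : Fin n) where
  open Graph H

  NewEdge : Rel (Fin n) 0ℓ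
  NewEdge a b = (a ≡ p × b ≡ q) ⊎ (a ≡ q × b ≡ p)

  add-edge : p ≢ q → Graph n
  add-edge p≢q = record
    { _~_    = λ a b → a ~ b ⊎ NewEdge a b
    ; _~?_   = λ a b → (a ~? b) ⊎-dec ((a ≟ p ×-dec b ≟ q) ⊎-dec (a ≟ q ×-dec b ≟ p))
    ; sym    = λ { (inj₁ a~b) → inj₁ (sym a~b)
                 ; (inj₂ (inj₁ (a≡p , b≡q))) → inj₂ (inj₂ (b≡q , a≡p))
                 ; (inj₂ (inj₂ (a≡q , b≡p))) → inj₂ (inj₁ (b≡p , a≡q)) }
    ; irrefl = λ { ≡.refl (inj₁ a~a) → irrefl ≡.refl a~a
                 ; ≡.refl (inj₂ (inj₁ (≡.refl , a≡q))) → p≢q a≡q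
                 ; ≡.refl (inj₂ (inj₂ (≡.refl , a≡p))) → p≢q (≡.sym a≡p) }
    }

  missing-add-edge : (na : NonAdjacent H p q) → missing (add-edge (proj₁ na)) < missing H
  missing-add-edge na@(p≢q , _) = count-mono-<
    (uncurry (nonAdjacent? (add-edge p≢q))) (uncurry (nonAdjacent? H))
    (λ (a≢b , a≁b) → a≢b , a≁b ∘ inj₁)
    (∈-pairs H p q) na (λ (_ , p≁q) → p≁q (inj₂ (inj₁ (≡.refl , ≡.refl))))

  both-ends : ∀ {a b} → NewEdge a b →
    (∀ {c d} → NewEdge c d → a ≡ c ⊎ a ≡ d) × (∀ {c d} → NewEdge c d → b ≡ c ⊎ b ≡ d)
  both-ends (inj₁ (≡.refl , ≡.refl)) =
    (λ { (inj₁ (c≡p , _)) → inj₁ (≡.sym c≡p) ; (inj₂ (_ , d≡p)) → inj₂ (≡.sym d≡p) }) ,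
    (λ { (inj₁ (_ , d≡q)) → inj₂ (≡.sym d≡q) ; (inj₂ (c≡q , _)) → inj₁ (≡.sym c≡q) })
  both-ends (inj₂ (≡.refl , ≡.refl)) =
    (λ { (inj₁ (_ , d≡q)) → inj₂ (≡.sym d≡q) ; (inj₂ (c≡q , _)) → inj₁ (≡.sym c≡q) }) ,
    (λ { (inj₁ (c≡p , _)) → inj₁ (≡.sym c≡p) ; (inj₂ (_ , d≡p)) → inj₂ (≡.sym d≡p) })

  spider-remove-edge : ∀ {u ts} (p≢q : p ≢ q) → 2 ≤ length ts →
    n + length ts ≤ suc (degree H p + degree H q) →
    SpanningSpider (add-edge p≢q) u ts → SpanningSpider H u ts
  spider-remove-edge {u} {ts} p≢q 2≤ big (M , S , perm)
    with M′ , S′ , r ← remove-edge H {Bad = NewEdge} both-ends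
      (λ { (inj₁ (≡.refl , ≡.refl)) → big
         ; (inj₂ (≡.refl , ≡.refl)) →
             ≤-trans big (≤-reflexive (cong suc (+-comm (degree H p) (degree H q)))) })
      2≤ perm S
    = M′ , S′ , ↭-trans (prep u r) perm

-- Edges are added while some non-adjacent pair reaches the threshold; a spider of the closed graph
-- is then pulled back through them one at a time.
spider-closure : ∀ {n} (G : Graph n) {u ts} → 2 ≤ length ts →
  (∀ H → G ⊑ H → Closed H (n + length ts) → SpanningSpider H u ts) → SpanningSpider G u ts
spider-closure {n} G {u} {ts} 2≤ closed-case = go G (<-wellFounded _) id
  where
  go : ∀ H → Acc _<_ (missing H) → G ⊑ H → SpanningSpider H u ts
  go H (acc rec) G⊑H with any? (λ x → any? (λ y →
    nonAdjacent? H x y ×-dec (n + length ts ≤? suc (degree H x + degree H y))))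
  ... | yes (x , y , na , big) = spider-remove-edge H x y (proj₁ na) 2≤ big
    (go (add-edge H x y (proj₁ na)) (rec (missing-add-edge H x y na)) (inj₁ ∘ G⊑H))
  ... | no none = closed-case H G⊑H λ x y na → ≰⇒> λ big → none (x , y , na , big)

-- Counting through a closed supergraph and comparison with the bounds

-- The bound on the number of (r+1)-cliques for k = c + t.
ψ : (n t r δ c : ℕ) → ℕ
ψ n t r δ c = (n ∸ 1 ∸ c) C suc r + c * ((c + t) C r) + δ C r

-- The vertices removed are `w`, which keeps its own degree term, and the first k - t vertices of
-- `L`.
numCliques-≤-ψ : ∀ {n} (G : Graph n) r t {w k} → t ≤ k → degree G w ≤ k →
  ∀ L → Unique (w ∷ L) → All (λ z → degree G z ≤ k) L → k ≤ length L + t →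
  numCliques G (suc r) ≤ ψ n t r (degree G w) (k ∸ t)
numCliques-≤-ψ {n} G r t {w} {k} t≤k w≤k L (w∉L ∷ uL) low k≤ = begin
  numCliques G (suc r)
    ≤⟨ numCliques-≤ G r (n ∸ suc j) (w ∷ D)
         (All.take⁺ j w∉L ∷ Unique.take⁺ j uL)
         (≤-trans (m≤n+m∸n n (suc j)) (≤-reflexive (cong (λ l → suc l + (n ∸ suc j)) (≡.sym ∣D∣)))) ⟩
  (n ∸ suc j) C suc r + (e + sum (map (λ v → degree G v C r) D))
    ≤⟨ +-monoʳ-≤ ((n ∸ suc j) C suc r) (+-monoʳ-≤ e
         (sum-map-≤ _ ((j + t) C r) D (All.map (λ z≤k → C-monoˡ-≤ r (≤-trans z≤k (≤-reflexive (≡.sym (m∸n+n≡m t≤k)))))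
           (All.take⁺ j low)))) ⟩
  (n ∸ suc j) C suc r + (e + length D * ((j + t) C r))
    ≡⟨ cong₂ (λ a l → a C suc r + (e + l * ((j + t) C r))) (≡.sym (∸-+-assoc n 1 j)) ∣D∣ ⟩
  (n ∸ 1 ∸ j) C suc r + (e + j * ((j + t) C r))
    ≡⟨ cong ((n ∸ 1 ∸ j) C suc r +_) (+-comm e _) ⟩
  (n ∸ 1 ∸ j) C suc r + (j * ((j + t) C r) + e)
    ≡⟨ +-assoc ((n ∸ 1 ∸ j) C suc r) _ _ ⟨
  ψ n t r (degree G w) j ∎
  where
  open ≤-Reasoning
  j = k ∸ t
  e = degree G w C r
  D = take j L
  ∣D∣ : length D ≡ j
  ∣D∣ = ≡.trans (length-take j L) (m≤n⇒m⊓n≡m (m≤n+o⇒m∸n≤o k t (≤-trans k≤ (≤-reflexive (+-comm (length L) t)))))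

module _ {n} (H : Graph n) where
  open Graph H

  -- The 2 pays for `y` and `w`. The vertex `w` is set apart because it is removed separately; it
  -- may equal `y` or be a neighbour of `y`, which only gives slack.
  n≤degree+low : ∀ y w {Low : Pred (Fin n) 0ℓ} (low? : Decidable Low) →
    (∀ z → NonAdjacent H z y → Low z) →
    n ≤ degree H y + (2 + count (λ z → ¬? (z ≟ w) ×-dec low? z) (allFin n))
  n≤degree+low y w {Low} low? low = begin
    n
      ≡⟨ length-tabulate {n = n} id ⟨
    length (allFin n)
      ≡⟨ cong length (filter-all U? (All.universal (λ _ → tt) (allFin n))) ⟨
    count U? (allFin n)
      ≤⟨ count-∪ U? (y ~?_) (λ z → z ≟ y ⊎-dec other? z) classify (allFin n) ⟩
    degree H y + count (λ z → z ≟ y ⊎-dec other? z) (allFin n)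
      ≤⟨ +-monoʳ-≤ (degree H y) (count-∪ _ (_≟ y) other? id (allFin n)) ⟩
    degree H y + (count (_≟ y) (allFin n) + count other? (allFin n))
      ≤⟨ +-monoʳ-≤ (degree H y) (+-mono-≤ (count-≡-≤1 y (allFin n) (Unique.allFin⁺ n))
           (count-∪ other? (_≟ w) rest? id (allFin n))) ⟩
    degree H y + (1 + (count (_≟ w) (allFin n) + count rest? (allFin n)))
      ≤⟨ +-monoʳ-≤ (degree H y) (s≤s (+-monoˡ-≤ _ (count-≡-≤1 w (allFin n) (Unique.allFin⁺ n)))) ⟩
    degree H y + (2 + count rest? (allFin n)) ∎
    where
    open ≤-Reasoning
    U? : Decidable {A = Fin n} (λ _ → ⊤)
    U? _ = yes tt
    rest? : Decidable (λ z → z ≢ w × Low z)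
    rest? z = ¬? (z ≟ w) ×-dec low? z
    other? : Decidable (λ z → z ≡ w ⊎ (z ≢ w × Low z))
    other? z = z ≟ w ⊎-dec rest? z
    classify : ∀ {z} → ⊤ → y ~ z ⊎ (z ≡ y ⊎ (z ≡ w ⊎ (z ≢ w × Low z)))
    classify {z} _ with y ~? z | z ≟ y | z ≟ w
    ... | yes y~z | _       | _       = inj₁ y~z
    ... | no  _   | yes z≡y | _       = inj₂ (inj₁ z≡y)
    ... | no  _   | no _    | yes z≡w = inj₂ (inj₂ (inj₁ z≡w))
    ... | no  y≁z | no z≢y  | no z≢w  = inj₂ (inj₂ (inj₂ (z≢w , low z (z≢y , y≁z ∘ sym))))

closed⇒numCliques-≤ : ∀ {n} (G H : Graph n) r t {δ} → HasMinDegree G δ → t ≤ δ → G ⊑ H →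
  Closed H (n + t) → ∀ x y → NonAdjacent H x y →
  ∃ λ k → δ ≤ k × k ≤ h n t × numCliques G (suc r) ≤ ψ n t r δ (k ∸ t)
closed⇒numCliques-≤ {n} G H r t ((w , ≡.refl) , δ≤) t≤δ G⊑H closed x₀ y₀ na₀
  with x , y , na , x≤y , max ← maximal-nonAdjacent H x₀ y₀ na₀
  = degree H x , δ≤k x , k≤h x y x≤y (closed x y na) ,
    numCliques-≤-ψ G r t (≤-trans t≤δ (δ≤k x)) (δ≤k x) (lows x)
      (All.tabulate (λ z∈ w≡z → proj₁ (lows-∈ x z∈) (≡.sym w≡z)) ∷ Unique.filter⁺ _ (Unique.allFin⁺ n))
      (All.tabulate (proj₂ ∘ lows-∈ x)) (k≤lows x y (closed x y na) max)
  where
  δ≤k : ∀ x → degree G w ≤ degree H x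
  δ≤k x = ≤-trans (δ≤ x) (degree-mono G H G⊑H x)
  low? : ∀ x → Decidable (λ z → degree G z ≤ degree H x)
  low? x z = degree G z ≤? degree H x
  lows : Fin n → List (Fin n)
  lows x = filter (λ z → ¬? (z ≟ w) ×-dec low? x z) (allFin n)
  lows-∈ : ∀ x {z} → z ∈ lows x → z ≢ w × degree G z ≤ degree H x
  lows-∈ x = proj₂ ∘ ∈-filter⁻ (λ z → ¬? (z ≟ w) ×-dec low? x z) {xs = allFin n}
  -- Since d(x) ≤ d(y), twice d(x) is at most n + t - 2; halving gives `h`.
  k≤h : ∀ x y → degree H x ≤ degree H y → suc (degree H x + degree H y) < n + t → degree H x ≤ h n t
  k≤h x y x≤y lt = begin
    degree H x               ≡⟨ m*n/n≡m (degree H x) 2 ⟨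
    (degree H x * 2) / 2     ≤⟨ /-monoˡ-≤ 2 twice ⟩
    (n + t ∸ 2) / 2          ∎
    where
    open ≤-Reasoning
    twice : degree H x * 2 ≤ n + t ∸ 2
    twice = begin
      degree H x * 2                   ≡⟨ *-comm (degree H x) 2 ⟩
      degree H x + (degree H x + 0)    ≡⟨ cong (degree H x +_) (+-identityʳ _) ⟩
      degree H x + degree H x          ≤⟨ +-monoʳ-≤ (degree H x) x≤y ⟩
      degree H x + degree H y          ≤⟨ ∸-monoˡ-≤ 2 lt ⟩
      n + t ∸ 2                        ∎
  k≤lows : ∀ x y → suc (degree H x + degree H y) < n + t →
    (∀ a b → NonAdjacent H a b → degree H a + degree H b ≤ degree H x + degree H y) →
    degree H x ≤ length (lows x) + t
  k≤lows x y lt max = +-cancelˡ-≤ (2 + degree H y) _ _ (begin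
    2 + degree H y + degree H x                ≡⟨ cong (2 +_) (+-comm (degree H y) (degree H x)) ⟩
    2 + (degree H x + degree H y)              ≤⟨ lt ⟩
    n + t                                      ≤⟨ +-monoˡ-≤ t (n≤degree+low H y w (low? x) low) ⟩
    degree H y + (2 + length (lows x)) + t
      ≡⟨ solve 3 (λ a l t → a :+ (con 2 :+ l) :+ t := con 2 :+ a :+ (l :+ t)) ≡.refl (degree H y) (length (lows x)) t ⟩
    2 + degree H y + (length (lows x) + t)     ∎)
    where
    open ≤-Reasoning
    open +-*-Solver
    -- Maximality is applied to the pair `z`, `y`, and d(y) is cancelled.
    low : ∀ z → NonAdjacent H z y → degree G z ≤ degree H x
    low z na = ≤-trans (degree-mono G H G⊑H z) (+-cancelʳ-≤ (degree H y) _ _ (max z y na))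

∸-shift : ∀ n t i → n ∸ 1 ∸ i ≡ n + t ∸ (i + t) ∸ 1
∸-shift n t i = begin
  n ∸ 1 ∸ i             ≡⟨ ∸-+-assoc n 1 i ⟩
  n ∸ (1 + i)           ≡⟨ cong (n ∸_) (+-comm 1 i) ⟩
  n ∸ (i + 1)           ≡⟨ ∸-+-assoc n i 1 ⟨
  n ∸ i ∸ 1             ≡⟨ cong (_∸ 1) ([m+n]∸[m+o]≡n∸o t n i) ⟨
  t + n ∸ (t + i) ∸ 1   ≡⟨ cong₂ (λ a b → a ∸ b ∸ 1) (+-comm t n) (+-comm t i) ⟩
  n + t ∸ (i + t) ∸ 1   ∎
  where open ≡.≡-Reasoning

-- At k = δ the term of the vertex of minimum degree equals the other `i` terms, giving the factor
-- `i + 1`, that is δ - t + 1.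
ψ-start : ∀ n t r i → ψ n t r (i + t) i ≡ f₁ n t (i + t) (suc r)
ψ-start n t r i = begin
  (n ∸ 1 ∸ i) C suc r + i * X + X
    ≡⟨ +-assoc ((n ∸ 1 ∸ i) C suc r) _ _ ⟩
  (n ∸ 1 ∸ i) C suc r + (i * X + X)
    ≡⟨ cong₂ (λ a b → a C suc r + b) (∸-shift n t i) (≡.trans (+-comm (i * X) X) (cong (_* X) (+-comm 1 i))) ⟩
  (n + t ∸ (i + t) ∸ 1) C suc r + (i + 1) * X
    ≡⟨ cong (λ j → (n + t ∸ (i + t) ∸ 1) C suc r + (j + 1) * X) (m+n∸n≡m i t) ⟨
  f₁ n t (i + t) (suc r) ∎
  where
  open ≡.≡-Reasoning
  X = (i + t) C r

ψ-end : ∀ n t r δ m → h n t ≡ m + t → ψ n t r δ m ≡ g₁ n t δ (suc r)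
ψ-end n t r δ m eq rewrite eq = cong₂ (λ a b → a C suc r + b * ((m + t) C r) + δ C r)
  (∸-shift n t m) (≡.sym (m+n∸n≡m m t))

ψ-≤-ends : ∀ n t r δ k → t ≤ δ → δ ≤ k → k ≤ h n t →
  ψ n t r δ (k ∸ t) ≤ f₁ n t δ (suc r) ⊔ g₁ n t δ (suc r)
ψ-≤-ends n t r δ k t≤δ δ≤k k≤h = begin
  F (k ∸ t) + δ C r
    ≤⟨ +-monoˡ-≤ (δ C r) (convex-≤-ends F (convex-bound (n ∸ 1) t r) (∸-monoˡ-≤ t δ≤k) (∸-monoˡ-≤ t k≤h)) ⟩
  F i ⊔ F m + δ C r
    ≡⟨ +-distribʳ-⊔ (δ C r) (F i) (F m) ⟩
  ψ n t r δ i ⊔ ψ n t r δ m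
    ≡⟨ cong₂ _⊔_ at-δ (ψ-end n t r δ m (≡.sym (m∸n+n≡m t≤h))) ⟩
  f₁ n t δ (suc r) ⊔ g₁ n t δ (suc r) ∎
  where
  open ≤-Reasoning
  F : ℕ → ℕ
  F c = (n ∸ 1 ∸ c) C suc r + c * ((c + t) C r)
  i = δ ∸ t
  m = h n t ∸ t
  t≤h = ≤-trans t≤δ (≤-trans δ≤k k≤h)
  at-δ : ψ n t r δ i ≡ f₁ n t δ (suc r)
  at-δ = subst (λ δ′ → ψ n t r δ′ i ≡ f₁ n t δ′ (suc r)) (m∸n+n≡m t≤δ) (ψ-start n t r i)

theorem2p5 : ∀ (n s t δ : ℕ) →
    s ≥ 2 → 3 ≤ t + 1 → t + 1 ≤ δ → δ ≤ h n t →
    (G : Graph n) → Connected G → HasMinDegree G δ →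
    numCliques G s > f₁ n t δ s ⊔ g₁ n t δ s →
    OneToManyDisjointPathCoverable G t
theorem2p5 n (suc r) zero    δ _ (s≤s ()) _ _ G _ minDeg many
theorem2p5 n (suc r) t@(suc _) δ _ 3≤t+1 t+1≤δ _ G _ minDeg many =
  coverable G λ u v inj v≢u → spider-closure G (2≤ v) (closed-case u v inj v≢u)
  where
  2≤ : (v : Fin t → Fin n) → 2 ≤ length (tabulate v)
  2≤ v = ≤-trans (s≤s⁻¹ (≤-trans 3≤t+1 (≤-reflexive (+-comm t 1)))) (≤-reflexive (≡.sym (length-tabulate v)))
  t≤δ : t ≤ δ
  t≤δ = ≤-trans (m≤m+n t 1) t+1≤δ
  closed-case : ∀ u v → Injective _≡_ _≡_ v → (∀ i → v i ≢ u) → ∀ H → G ⊑ H →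
    Closed H (n + length (tabulate v)) → SpanningSpider H u (tabulate v)
  closed-case u v inj v≢u H G⊑H closed with any? (λ x → any? (nonAdjacent? H x))
  ... | no none = complete-spider H
    (λ a b a≢b → decidable-stable (Graph._~?_ H a b) λ a≁b → none (a , b , a≢b , a≁b))
    (All.tabulate⁺ (λ i → v≢u i ∘ ≡.sym) ∷ Unique.tabulate⁺ inj)
  ... | yes (x , y , na)
      with k , δ≤k , k≤h , le ← closed⇒numCliques-≤ G H r t minDeg t≤δ G⊑H
             (subst (λ l → Closed H (n + l)) (length-tabulate v) closed) x y na
      = contradiction many (≤⇒≯ (≤-trans le (ψ-≤-ends n t r δ k t≤δ δ≤k k≤h)))
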